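{- Let $k$ be a positive integer, let $G$ be a finite graph and let $X,Y\subseteq V(G)$. Then at least one of the following holds: (1) there exist $k$ pairwise non-adjacent $X$-$Y$-paths in $G$; (2) there exists a set of fewer than $2^{\chi_s'(G)}k$ vertices of $G$ which separates $X$ and $Y$.
   Context: An $X$-$Y$-path is a path with one endpoint in $X$ and the other endpoint in $Y$; a single vertex of $X\cap Y$ counts as an $X$-$Y$-path (of length $0$). A set $Z\subseteq V(G)$ separates $X$ and $Y$ if $Z$ intersects every $X$-$Y$-path. Paths are called pairwise non-adjacent if they are pairwise vertex-disjoint and there is no edge of $G$ joining a vertex of one of them to a vertex of another (i.e. their pairwise distance in $G$ is at least $2$). An induced matching of $G$ is a set $M\subseteq E(G)$ such that any two distinct edges of $M$ share no vertex and no edge of $G$ joins an endpoint of one to an endpoint of the other. A strong edge colouring of $G$ is a partition of $E(G)$ into induced matchings, and the strong chromatic index $\chi_s'(G)$ is the minimum number of parts in a strong edge colouring of $G$. -}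

module Defs where

open import Data.Nat using (ℕ; _≤_)
open import Data.Fin using (Fin)
open import Data.Fin.Subset using (Subset; _∈_)
open import Data.Bool using (Bool; T)
open import Data.List using (List; []; _∷_; last)
open import Data.Maybe using (just)
open import Data.List.Relation.Unary.Unique.Propositional using (Unique)
open import Data.List.Relation.Unary.Linked using (Linked)
import Data.List.Membership.Propositional as L
open import Data.Product using (Σ; _×_; ∃; ∃-syntax)
open import Data.Sum using (_⊎_)
open import Relation.Nullary using (¬_)
open import Relation.Binary.PropositionalEquality using (_≡_; _≢_)

record Graph : Set where
  field
    n     : ℕ
    adj   : Fin n → Fin n → Bool
    sym   : ∀ u v → adj u v ≡ adj v u
    irrefl : ∀ u → ¬ T (adj u u)

module _ (G : Graph) where
  open Graph G

  Adj : Fin n → Fin n → Set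
  Adj u v = T (adj u v)

  IsPath : List (Fin n) → Set
  IsPath p = (p ≢ []) × Unique p × Linked Adj p

  IsXYPath : Subset n → Subset n → List (Fin n) → Set
  IsXYPath X Y p = IsPath p × ∃[ a ] ∃[ b ]
    ((Σ (List (Fin n)) λ q → p ≡ a ∷ q) × last p ≡ just b ×
     ((a ∈ X × b ∈ Y) ⊎ (a ∈ Y × b ∈ X)))

  NonAdjacent : List (Fin n) → List (Fin n) → Set
  NonAdjacent p q = ∀ {u v} → u L.∈ p → v L.∈ q → (u ≢ v) × ¬ Adj u v

  NonAdjPaths : ℕ → Subset n → Subset n → Set
  NonAdjPaths k X Y = Σ (Fin k → List (Fin n)) λ P →
    (∀ i → IsXYPath X Y (P i)) × (∀ i j → i ≢ j → NonAdjacent (P i) (P j))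

  Separates : Subset n → Subset n → Subset n → Set
  Separates Z X Y = ∀ p → IsXYPath X Y p → ∃[ v ] (v L.∈ p × v ∈ Z)

  -- A strong edge colouring with c colours: each edge {u,v} gets a colour
  -- (independent of orientation), and every colour class is an induced matching:
  -- two distinct edges of the same colour share no vertex and no edge of G
  -- joins an endpoint of one to an endpoint of the other.
  record StrongEdgeColouring (c : ℕ) : Set where
    field
      colour : ∀ u v → Adj u v → Fin c
      colour-sym : ∀ u v (h : Adj u v) (h' : Adj v u) → colour u v h ≡ colour v u h'
      induced : ∀ u v x y (h₁ : Adj u v) (h₂ : Adj x y) →
        colour u v h₁ ≡ colour x y h₂ →
        ((u ≡ x × v ≡ y) ⊎ (u ≡ y × v ≡ x)) ⊎
        (∀ a b → (a ≡ u ⊎ a ≡ v) → (b ≡ x ⊎ b ≡ y) → (a ≢ b) × ¬ Adj a b)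

  IsStrongChromaticIndex : ℕ → Set
  IsStrongChromaticIndex c =
    StrongEdgeColouring c × (∀ c' → StrongEdgeColouring c' → c ≤ c')

{-# OPTIONS --safe #-}
module Submission where

-- Menger's theorem gives 2^χ k disjoint induced X-Y-paths. The colours are then removed one
-- at a time, halving the number of paths while keeping the invariant that no two of them
-- are joined by an edge of a treated colour. For the next colour, with matching M, contract
-- the M-edges inside the union of the 2K current paths. A separator of fewer than K
-- contracted vertices would expand to fewer than 2K vertices meeting all 2K paths, so Menger
-- yields K paths disjoint after contraction, hence joined by no M-edge. An edge uv of an
-- earlier colour between two new paths would lie on an old path; each new path misses one
-- of u and v, so it leaves the old path through an M-edge at the other, and the two M-edges
-- at the ends of uv contradict that M is an induced matching.

open import Defs
open import Data.Bool using (Bool; true; false; T)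
open import Data.Bool.Properties using (T?; T-irrelevant)
open import Data.Empty using (⊥-elim)
open import Data.Fin using (Fin; zero; suc; toℕ; inject≤)
open import Data.Fin.Properties as Fin using (_≟_; any?)
open import Data.Fin.Subset using (Subset; ∣_∣; inside; outside) renaming (_∈_ to _∈ₛ_; ⊥ to ⊥ₛ)
open import Data.Fin.Subset.Properties using (∣⊥∣≡0) renaming (_∈?_ to _∈ₛ?_)
open import Data.List using (List; []; _∷_; _++_; allFin; cartesianProduct; filter; last; length; lookup; map)
import Data.List.Membership.DecPropositional as DecMembership
open import Data.List.Membership.Propositional using (_∈_; _∉_)
open import Data.List.Membership.Propositional.Properties using (∈-allFin; ∈-cartesianProduct⁺; ∈-filter⁺; ∈-filter⁻; ∈-lookup; ∈-map⁺; ∈-map⁻; ∈-++⁺ˡ; ∈-++⁺ʳ)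
open import Data.List.Properties using (length-++; length-map)
open import Data.List.Relation.Binary.Subset.Propositional using (_⊆_)
open import Data.List.Relation.Unary.All as All using ([])
open import Data.List.Relation.Unary.AllPairs using ([]; _∷_)
open import Data.List.Relation.Unary.Any using (here; there; index)
open import Data.List.Relation.Unary.Any.Properties using (lookup-index)
open import Data.List.Relation.Unary.Linked using (Linked; [-]; _∷_)
open import Data.List.Relation.Unary.Unique.Propositional using (Unique)
open import Data.List.Relation.Unary.Unique.Propositional.Properties using (allFin⁺; filter⁺)
open import Data.Maybe using (just)
open import Data.Nat as ℕ using (ℕ; zero; suc; _≤_; _<_; _+_; _*_; _^_; s≤s)
import Data.Nat.Properties as ℕ
open import Data.Product using (Σ; ∃₂; ∃-syntax; _×_; _,_; proj₁; proj₂)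
open import Data.Sum using (_⊎_; inj₁; inj₂; [_,_]′)
open import Data.Vec using (_∷_; _[_]≔_)
open import Data.Vec.Properties using ([]≔-updates; []≔-minimal)
open import Function using (_∘_; id; case_of_)
open import Level using (0ℓ)
open import Relation.Binary using (Rel; Symmetric) renaming (Decidable to Decidable₂)
open import Relation.Binary.PropositionalEquality using (_≡_; _≢_; refl; sym; trans; cong; cong₂; subst)
open import Relation.Nullary using (¬_; Dec; yes; no; contradiction)
open import Relation.Nullary.Decidable using (_×-dec_; _⊎-dec_; map′)
open import Relation.Unary using (Pred; Decidable)

private
  variable
    n k : ℕ

-- Pigeonhole counting on lists

_∈?_ : (v : Fin n) (vs : List (Fin n)) → Dec (v ∈ vs)
_∈?_ = DecMembership._∈?_ _≟_

lookup-injective : ∀ {A : Set} {xs : List A} → Unique xs →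
                   ∀ {i j} → lookup xs i ≡ lookup xs j → i ≡ j
lookup-injective (x∉ ∷ u) {zero}  {zero}  eq = refl
lookup-injective (x∉ ∷ u) {zero}  {suc j} eq = contradiction eq (All.lookup x∉ (∈-lookup j))
lookup-injective (x∉ ∷ u) {suc i} {zero}  eq = contradiction (sym eq) (All.lookup x∉ (∈-lookup i))
lookup-injective (x∉ ∷ u) {suc i} {suc j} eq = cong suc (lookup-injective u eq)

injective⇒≤length : ∀ {A : Set} (xs : List A) (f : Fin k → A) → (∀ i → f i ∈ xs) →
                    (∀ {i j} → f i ≡ f j → i ≡ j) → k ≤ length xs
injective⇒≤length xs f f∈ inj = Fin.injective⇒≤ {f = λ i → index (f∈ i)} λ {i} {j} eq →
  inj (trans (lookup-index (f∈ i)) (trans (cong (lookup xs) eq) (sym (lookup-index (f∈ j)))))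

-- A missed `x` would extend `f` to an injection of `suc k` indices into a list of length at most
-- `k`.
injective⇒surjective : (xs : List (Fin n)) (f : Fin k → Fin n) → length xs ≤ k →
                       (∀ i → f i ∈ xs) → (∀ {i j} → f i ≡ f j → i ≡ j) →
                       ∀ {x} → x ∈ xs → ∃[ i ] f i ≡ x
injective⇒surjective {k = k} xs f ≤k f∈ inj {x} x∈ with any? (λ i → f i ≟ x)
... | yes hit = hit
... | no miss = contradiction ≤k (ℕ.<⇒≱ (injective⇒≤length xs g g∈ g-inj))
  where
  g : Fin (suc k) → _
  g zero    = x
  g (suc i) = f i
  g∈ : ∀ i → g i ∈ xs
  g∈ zero    = x∈
  g∈ (suc i) = f∈ i
  g-inj : ∀ {i j} → g i ≡ g j → i ≡ j
  g-inj {zero}  {zero}  eq = refl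
  g-inj {zero}  {suc j} eq = contradiction (j , sym eq) miss
  g-inj {suc i} {zero}  eq = contradiction (i , eq) miss
  g-inj {suc i} {suc j} eq = cong suc (inj eq)

-- Walks

-- Vertices may repeat: the Menger arguments work with walks throughout, and `tighten` later
-- extracts induced paths from them.
data Walk {n} (R : Rel (Fin n) 0ℓ) : Fin n → List (Fin n) → Fin n → Set where
  [_] : ∀ u → Walk R u (u ∷ []) u
  _∷_ : ∀ {u v w b} → R u v → Walk R v w b → Walk R u (u ∷ w) b

private
  variable
    R R′ : Rel (Fin n) 0ℓ
    A B : Pred (Fin n) 0ℓ
    a b c d : Fin n
    w w₁ w₂ : List (Fin n)

head∈ : Walk R a w b → a ∈ w
head∈ [ _ ]   = here refl
head∈ (_ ∷ _) = here refl

last∈ : Walk R a w b → b ∈ w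
last∈ [ _ ]   = here refl
last∈ (_ ∷ W) = there (last∈ W)

mapWalk : (∀ {u v} → u ∈ w → v ∈ w → R u v → R′ u v) → Walk R a w b → Walk R′ a w b
mapWalk f [ u ]   = [ u ]
mapWalk f (r ∷ W) = f (here refl) (there (head∈ W)) r ∷ mapWalk (λ p q → f (there p) (there q)) W

join : Walk R a w₁ b → Walk R b w₂ c →
       ∃[ w ] Walk R a w c × (∀ {v} → v ∈ w → v ∈ w₁ ⊎ v ∈ w₂)
join [ _ ]   W′ = _ , W′ , inj₂
join (r ∷ W) W′ with w , J , split ← join W W′ = _ , r ∷ J , λ where
  (here refl) → inj₁ (here refl)
  (there v∈)  → [ inj₁ ∘ there , inj₂ ]′ (split v∈)

joinVia : R b c → Walk R a w₁ b → Walk R c w₂ d →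
          ∃[ w ] Walk R a w d × (∀ {v} → v ∈ w → v ∈ w₁ ⊎ v ∈ w₂)
joinVia r W W′ with w , J , split ← join W (r ∷ W′) = w , J , λ v∈ → case split v∈ of λ where
  (inj₁ v∈₁)         → inj₁ v∈₁
  (inj₂ (here refl)) → inj₁ (last∈ W)
  (inj₂ (there v∈₂)) → inj₂ v∈₂

suffix : Walk R a w b → ∀ {v} → v ∈ w → ∃[ u ] Walk R v u b × u ⊆ w
suffix W@([ _ ]) (here refl) = _ , W , id
suffix W@(_ ∷ _) (here refl) = _ , W , id
suffix (_ ∷ W)   (there v∈) with u , S , u⊆ ← suffix W v∈ = u , S , there ∘ u⊆

Avoids : List (Fin n) → Fin n → List (Fin n) → Set
Avoids P v w = ∀ {z} → z ∈ w → z ≡ v ⊎ z ∉ P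

-- The part of a walk up to its first vertex in P, and from its last vertex in P.

record Arrival {n} (R : Rel (Fin n) 0ℓ) (P : List (Fin n)) (a : Fin n) (w : List (Fin n)) : Set where
  field
    end    : Fin n
    trace  : List (Fin n)
    end∈   : end ∈ P
    walk   : Walk R a trace end
    within : trace ⊆ w
    avoids : Avoids P end trace
    -- Cutting the trace at `v` leaves a piece that is off `P` except possibly at `v`; `common∈S`
    -- splices two such pieces.
    prefix : ∀ {v} → v ∈ trace → ∃[ u ] Walk R a u v × Avoids P v u

record Departure {n} (R : Rel (Fin n) 0ℓ) (P : List (Fin n)) (w : List (Fin n)) (b : Fin n) : Set where
  field
    start    : Fin n
    trace    : List (Fin n)
    start∈   : start ∈ P
    walk     : Walk R start trace b
    within   : trace ⊆ w
    avoids   : Avoids P start trace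
    postfix  : ∀ {v} → v ∈ trace → ∃[ u ] Walk R v u b × Avoids P v u

avoids-singleton : ∀ {P : List (Fin n)} {v} → Avoids P v (v ∷ [])
avoids-singleton (here refl) = inj₁ refl

arrival : (P : List (Fin n)) → Walk R a w b → b ∈ P → Arrival R P a w
arrival {a = a} P W b∈ with a ∈? P
... | yes a∈ = record
  { end∈   = a∈
  ; walk   = [ a ]
  ; within = λ { (here refl) → head∈ W }
  ; avoids = avoids-singleton
  ; prefix = λ { (here refl) → _ , [ a ] , avoids-singleton }
  }
arrival P [ _ ] b∈ | no a∉ = contradiction b∈ a∉
arrival {R = R} {a = a} P (r ∷ W) b∈ | no a∉ = record
  { end∈   = end∈
  ; walk   = r ∷ walk
  ; within = λ { (here refl) → here refl ; (there v∈) → there (within v∈) }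
  ; avoids = cons avoids
  ; prefix = λ where
      (here refl) → _ , [ a ] , avoids-singleton
      (there v∈)  → let u , U , av = prefix v∈ in _ , r ∷ U , cons av
  }
  where
  open Arrival (arrival P W b∈)
  cons : ∀ {v u} → Avoids P v u → Avoids P v (a ∷ u)
  cons av (here refl) = inj₂ a∉
  cons av (there z∈)  = av z∈

departure : (P : List (Fin n)) → Walk R a w b → (∀ {z} → z ∈ w → z ∉ P) ⊎ Departure R P w b
departure {a = a} P [ _ ] with a ∈? P
... | no a∉  = inj₁ λ { (here refl) → a∉ }
... | yes a∈ = inj₂ record
  { start∈  = a∈
  ; walk    = [ a ]
  ; within  = id
  ; avoids  = avoids-singleton
  ; postfix = λ { (here refl) → _ , [ a ] , avoids-singleton }
  }
departure {a = a} P (r ∷ W) with departure P W | a ∈? P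
... | inj₂ D | _ = inj₂ record { Departure D ; within = there ∘ Departure.within D }
... | inj₁ none | no a∉ = inj₁ λ { (here refl) → a∉ ; (there z∈) → none z∈ }
... | inj₁ none | yes a∈ = inj₂ record
  { start∈  = a∈
  ; walk    = r ∷ W
  ; within  = id
  ; avoids  = avoid
  ; postfix = λ where
      (here refl) → _ , r ∷ W , avoid
      (there v∈)  → let u , U , u⊆ = suffix W v∈ in u , U , λ z∈ → inj₂ (none (u⊆ z∈))
  }
  where
  avoid : Avoids P a (a ∷ _)
  avoid (here refl) = inj₁ refl
  avoid (there z∈)  = inj₂ (none z∈)

Connects : Rel (Fin n) 0ℓ → (A B : Pred (Fin n) 0ℓ) → List (Fin n) → Set
Connects R A B w = ∃₂ λ a b → A a × B b × Walk R a w b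

Linkage : Rel (Fin n) 0ℓ → (A B : Pred (Fin n) 0ℓ) → ℕ → Set
Linkage {n} R A B k = Σ (Fin k → List (Fin n)) λ p →
  (∀ i → Connects R A B (p i)) × (∀ {i j v} → v ∈ p i → v ∈ p j → i ≡ j)

Separator : Rel (Fin n) 0ℓ → (A B : Pred (Fin n) 0ℓ) → List (Fin n) → Set
Separator R A B Z = ∀ {w} → Connects R A B w → ∃[ v ] v ∈ w × v ∈ Z

-- Menger's theorem

-- Menger's theorem is proved for directed graphs given by a list of arcs, so that induction on the
-- list deletes one arc at a time.
Edge : List (Fin n × Fin n) → Rel (Fin n) 0ℓ
Edge es u v = (u , v) ∈ es

module _ {n} {x y : Fin n} {es : List (Fin n × Fin n)} (S : List (Fin n)) where

  private
    E⁺ = Edge ((x , y) ∷ es)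
    E  = Edge es

  splitFirst : Walk E⁺ a w b →
    (Walk E a w b × (∀ {z} → z ∈ w → z ∉ x ∷ S)) ⊎
    ∃₂ λ p w′ → p ∈ x ∷ S × Walk E a w′ p × w′ ⊆ w
  splitFirst {a = a} W with a ∈? (x ∷ S)
  ... | yes a∈ = inj₂ (a , _ , a∈ , [ a ] , λ { (here refl) → head∈ W })
  splitFirst [ u ] | no a∉ = inj₁ ([ u ] , λ { (here refl) → a∉ })
  splitFirst (here refl ∷ W) | no a∉ = contradiction (here refl) a∉
  splitFirst (there r ∷ W) | no a∉ with splitFirst W
  ... | inj₁ (W′ , none) = inj₁ (r ∷ W′ , λ { (here refl) → a∉ ; (there z∈) → none z∈ })
  ... | inj₂ (p , w′ , p∈ , W′ , w′⊆) = inj₂ (p , _ , p∈ , r ∷ W′ ,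
          λ { (here refl) → here refl ; (there z∈) → there (w′⊆ z∈) })

  splitLast : Walk E⁺ a w b →
    (Walk E a w b × (∀ {z} → z ∈ w → z ∉ y ∷ S)) ⊎
    ∃₂ λ q w′ → q ∈ y ∷ S × Walk E q w′ b × w′ ⊆ w
  splitLast {a = a} [ _ ] with a ∈? (y ∷ S)
  ... | yes a∈ = inj₂ (a , _ , a∈ , [ a ] , id)
  ... | no a∉  = inj₁ ([ a ] , λ { (here refl) → a∉ })
  splitLast {a = a} (r ∷ W) with splitLast W
  ... | inj₂ (q , w′ , q∈ , W′ , w′⊆) = inj₂ (q , w′ , q∈ , W′ , there ∘ w′⊆)
  -- The new arc would put `y` at the head of the remaining walk, which avoids `y ∷ S`.
  splitLast (here refl ∷ W) | inj₁ (W′ , none) = contradiction (here refl) (none (head∈ W))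
  splitLast {a = a} (there r ∷ W) | inj₁ (W′ , none) with a ∈? (y ∷ S)
  ... | yes a∈ = inj₂ (a , _ , a∈ , r ∷ W′ , id)
  ... | no a∉  = inj₁ (r ∷ W′ , λ { (here refl) → a∉ ; (there z∈) → none z∈ })

  module _ (sepS : Separator E A B S) where

    -- A walk meeting `x ∷ S` has an initial piece in `E`, which `T` hits. A walk missing `x ∷ S` is
    -- a walk in `E` avoiding `S`, which `sepS` forbids.
    separatorFirst : ∀ {T} → Separator E A (_∈ x ∷ S) T → Separator E⁺ A B T
    separatorFirst sepT (a , b , Aa , Bb , W) with splitFirst W
    ... | inj₁ (W′ , none) = case sepS (a , b , Aa , Bb , W′) of λ where
            (v , v∈ , v∈S) → contradiction (there v∈S) (none v∈)
    ... | inj₂ (p , w′ , p∈ , W′ , w′⊆) = case sepT (a , p , Aa , p∈ , W′) of λ where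
            (v , v∈ , v∈T) → v , w′⊆ v∈ , v∈T

    separatorLast : ∀ {T} → Separator E (_∈ y ∷ S) B T → Separator E⁺ A B T
    separatorLast sepT (a , b , Aa , Bb , W) with splitLast W
    ... | inj₁ (W′ , none) = case sepS (a , b , Aa , Bb , W′) of λ where
            (v , v∈ , v∈S) → contradiction (there v∈S) (none v∈)
    ... | inj₂ (q , w′ , q∈ , W′ , w′⊆) = case sepT (q , b , q∈ , Bb , W′) of λ where
            (v , v∈ , v∈T) → v , w′⊆ v∈ , v∈T

    -- A walk that takes the new arc passes through `y`, which is already in `S`.
    separatorAddEdge : y ∈ S → Separator E⁺ A B S
    separatorAddEdge y∈S (a , b , Aa , Bb , W) with splitLast W
    ... | inj₁ (W′ , _) = sepS (a , b , Aa , Bb , W′)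
    ... | inj₂ (q , w′ , here refl , W′ , w′⊆) = y , w′⊆ (head∈ W′) , y∈S
    ... | inj₂ (q , w′ , there q∈ , W′ , w′⊆) = q , w′⊆ (head∈ W′) , q∈

    -- Linkages into x ∷ S and out of y ∷ S meet only in S, so they can be
    -- concatenated, the two paths at x and y being joined by the edge (x , y).
    concatLinkages : y ∉ S → length S < k → Linkage E A (_∈ x ∷ S) k →
                     Linkage E (_∈ y ∷ S) B k → Linkage E⁺ A B k
    concatLinkages {k = k} y∉S S<k (p , p-conn , p-disj) (q , q-conn , q-disj) =
      (λ i → proj₁ (whole i)) ,
      (λ i → let a , _ , Aa , _ = p-conn i ; _ , b , _ , Bb , _ = q-conn (σ i) in
             a , b , Aa , Bb , proj₁ (proj₂ (whole i))) ,
      λ {i} {j} v∈i v∈j → disjoint (proj₂ (proj₂ (whole i)) v∈i) (proj₂ (proj₂ (whole j)) v∈j)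
      where
      into : ∀ i → Arrival E (x ∷ S) (proj₁ (p-conn i)) (p i)
      into i = let _ , _ , _ , p∈ , W = p-conn i in arrival (x ∷ S) W p∈

      outOf : ∀ j → Departure E (y ∷ S) (q j) (proj₁ (proj₂ (q-conn j)))
      outOf j with _ , _ , s∈ , _ , W ← q-conn j with departure (y ∷ S) W
      ... | inj₂ D    = D
      ... | inj₁ none = contradiction s∈ (none (head∈ W))

      module In i = Arrival (into i)
      module Out j = Departure (outOf j)

      In-disj : ∀ {i j v} → v ∈ In.trace i → v ∈ In.trace j → i ≡ j
      In-disj {i} {j} v∈i v∈j = p-disj (In.within i v∈i) (In.within j v∈j)

      Out-disj : ∀ {i j v} → v ∈ Out.trace i → v ∈ Out.trace j → i ≡ j
      Out-disj {i} {j} v∈i v∈j = q-disj (Out.within i v∈i) (Out.within j v∈j)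

      end-inj : ∀ {i j} → In.end i ≡ In.end j → i ≡ j
      end-inj {i} {j} eq =
        In-disj (last∈ (In.walk i)) (subst (_∈ In.trace j) (sym eq) (last∈ (In.walk j)))

      startingAt : ∀ {v} → v ∈ y ∷ S → ∃[ j ] Out.start j ≡ v
      -- `S<k` says that `y ∷ S` has at most `k` entries, so the `k` distinct starting vertices
      -- exhaust it.
      startingAt = injective⇒surjective (y ∷ S) Out.start S<k Out.start∈ λ {i} {j} eq →
        Out-disj (head∈ (Out.walk i)) (subst (_∈ Out.trace j) (sym eq) (head∈ (Out.walk j)))

      -- A path arriving at `x` continues from `y` across the new arc; any other continues from its
      -- own end in `S`.
      match : ∀ i → ∃[ j ] ((In.end i ≡ x × Out.start j ≡ y) ⊎ (In.end i ∈ S × Out.start j ≡ In.end i))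
      match i with In.end∈ i
      ... | here e≡x  = let j , eq = startingAt (here refl) in j , inj₁ (e≡x , eq)
      ... | there e∈S = let j , eq = startingAt (there e∈S) in j , inj₂ (e∈S , eq)

      σ : Fin k → Fin k
      σ i = proj₁ (match i)

      start-inj : ∀ i j → Out.start (σ i) ≡ Out.start (σ j) → In.end i ≡ In.end j
      start-inj i j eq with proj₂ (match i) | proj₂ (match j)
      ... | inj₁ (ei , _)  | inj₁ (ej , _)  = trans ei (sym ej)
      ... | inj₂ (_ , si)  | inj₂ (_ , sj)  = trans (sym si) (trans eq sj)
      ... | inj₁ (_ , si)  | inj₂ (∈S , sj) =
              contradiction (subst (_∈ S) (trans (sym sj) (trans (sym eq) si)) ∈S) y∉S
      ... | inj₂ (∈S , si) | inj₁ (_ , sj)  =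
              contradiction (subst (_∈ S) (trans (sym si) (trans eq sj)) ∈S) y∉S

      weaken : Walk E a w b → Walk E⁺ a w b
      weaken = mapWalk λ _ _ → there

      whole : ∀ i → ∃[ w ] Walk E⁺ (proj₁ (p-conn i)) w (proj₁ (proj₂ (q-conn (σ i)))) ×
              (∀ {v} → v ∈ w → v ∈ In.trace i ⊎ v ∈ Out.trace (σ i))
      whole i with match i
      ... | j , inj₁ (ei , sj) =
              joinVia (here (cong₂ _,_ ei sj)) (weaken (In.walk i)) (weaken (Out.walk j))
      ... | j , inj₂ (_ , sj)  = join (weaken (In.walk i))
              (subst (λ u → Walk E⁺ u (Out.trace j) _) sj (weaken (Out.walk j)))

      -- A common vertex outside S would give a walk in E from A to B avoiding S.
      common∈S : ∀ {i j v} → v ∈ In.trace i → v ∈ Out.trace j → v ∈ S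
      common∈S {i} {j} {v} v∈i v∈j with v ∈? S
      ... | yes v∈S = v∈S
      ... | no v∉S
        with _ , _ , Aa , _ ← p-conn i | _ , _ , _ , Bb , _ ← q-conn j
           | _ , U₁ , avoid₁ ← In.prefix i v∈i | _ , U₂ , avoid₂ ← Out.postfix j v∈j
        with _ , J , split ← join U₁ U₂
        with z , z∈ , z∈S ← sepS (_ , _ , Aa , Bb , J)
        with split z∈
      ... | inj₁ z∈₁ = [ (λ { refl → z∈S }) , contradiction (there z∈S) ]′ (avoid₁ z∈₁)
      ... | inj₂ z∈₂ = [ (λ { refl → z∈S }) , contradiction (there z∈S) ]′ (avoid₂ z∈₂)

      -- A common vertex lies in `S`, so by `avoids` it is the end of the first trace and the start
      -- of the second; `match` then pairs the two.
      cross : ∀ {i j v} → v ∈ In.trace i → v ∈ Out.trace (σ j) → i ≡ j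
      cross {i} {j} {v} v∈i v∈j
        with v∈S ← common∈S {i} {σ j} v∈i v∈j
        with In.avoids i v∈i | Out.avoids (σ j) v∈j
      ... | inj₂ v∉ | _ = contradiction (there v∈S) v∉
      ... | inj₁ _ | inj₂ v∉ = contradiction (there v∈S) v∉
      ... | inj₁ v≡e | inj₁ v≡s with proj₂ (match j)
      ...   | inj₁ (_ , s≡y) = contradiction (subst (_∈ S) (trans v≡s s≡y) v∈S) y∉S
      ...   | inj₂ (_ , s≡e) = end-inj (trans (sym v≡e) (trans v≡s s≡e))

      disjoint : ∀ {i j v} → v ∈ In.trace i ⊎ v ∈ Out.trace (σ i) →
                 v ∈ In.trace j ⊎ v ∈ Out.trace (σ j) → i ≡ j
      disjoint (inj₁ v∈i) (inj₁ v∈j) = In-disj v∈i v∈j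
      disjoint {i} {j} (inj₂ v∈i) (inj₂ v∈j) =
        end-inj (start-inj i j (cong Out.start (Out-disj v∈i v∈j)))
      disjoint (inj₁ v∈i) (inj₂ v∈j) = cross v∈i v∈j
      disjoint (inj₂ v∈i) (inj₁ v∈j) = sym (cross v∈j v∈i)

-- Every walk is a single vertex here, so the list of vertices common to `A` and `B` serves as
-- linkage if long and as separator if short.
mengerEdgeless : Decidable A → Decidable B → ∀ k →
  Linkage (Edge []) A B k ⊎ ∃[ Z ] length Z < k × Separator (Edge []) A B Z
mengerEdgeless {n} {A} {B} A? B? k = separateOrLink (k ℕ.≤? length common)
  where
  both? : Decidable (λ v → A v × B v)
  both? v = A? v ×-dec B? v

  common : List (Fin n)
  common = filter both? (allFin n)

  separateOrLink : Dec (k ≤ length common) →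
    Linkage (Edge []) A B k ⊎ ∃[ Z ] length Z < k × Separator (Edge []) A B Z
  separateOrLink (no k≰) = inj₂ (common , ℕ.≰⇒> k≰ , λ where
    (a , _ , Aa , Ba , [ _ ]) → a , here refl , ∈-filter⁺ both? (∈-allFin a) (Aa , Ba))
  separateOrLink (yes k≤) = inj₁
    ( (λ i → lookup common (inject≤ i k≤) ∷ [])
    , (λ i → let _ , Av , Bv = ∈-filter⁻ both? {xs = allFin n} (∈-lookup (inject≤ i k≤)) in
             _ , _ , Av , Bv , [ _ ])
    , λ { (here refl) (here eq) → Fin.inject≤-injective k≤ k≤ _ _
                                    (lookup-injective (filter⁺ both? (allFin⁺ n)) eq) })

-- Göring's proof: delete an edge (x , y); a small separator S of the rest leads
-- to the two subproblems of linking A to x ∷ S and y ∷ S to B.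
menger : (es : List (Fin n × Fin n)) → Decidable A → Decidable B → ∀ k →
         Linkage (Edge es) A B k ⊎ ∃[ Z ] length Z < k × Separator (Edge es) A B Z
menger [] A? B? k = mengerEdgeless A? B? k
menger ((x , y) ∷ es) A? B? k with menger es A? B? k
... | inj₁ (p , conn , disj) = inj₁ (p , (λ i → let a , b , Aa , Bb , W = conn i in
        a , b , Aa , Bb , mapWalk (λ _ _ → there) W) , disj)
... | inj₂ (S , S<k , sepS) with y ∈? S
...   | yes y∈S = inj₂ (S , S<k , separatorAddEdge S sepS y∈S)
...   | no y∉S with menger es A? (λ v → v ∈? (x ∷ S)) k | menger es (λ v → v ∈? (y ∷ S)) B? k
...     | inj₂ (T , T<k , sepT) | _ = inj₂ (T , T<k , separatorFirst S sepS sepT)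
...     | inj₁ _ | inj₂ (T , T<k , sepT) = inj₂ (T , T<k , separatorLast S sepS sepT)
...     | inj₁ L | inj₁ L′ = inj₁ (concatLinkages S sepS y∉S S<k L L′)

-- Menger's theorem after contracting the fibres of a map

module Contraction {n} {R : Rel (Fin n) 0ℓ} {A B : Pred (Fin n) 0ℓ} (r : Fin n → Fin n)
  (fibre-connected : ∀ {u v} → r u ≡ r v → u ≡ v ⊎ R u v)
  (R? : Decidable₂ R) (A? : Decidable A) (B? : Decidable B) where

  private
    R?′ : Decidable (λ (e : Fin n × Fin n) → R (proj₁ e) (proj₂ e))
    R?′ (u , v) = R? u v

    pairs : List (Fin n × Fin n)
    pairs = cartesianProduct (allFin n) (allFin n)

    r² : Fin n × Fin n → Fin n × Fin n
    r² (u , v) = r u , r v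

    edges : List (Fin n × Fin n)
    edges = map r² (filter R?′ pairs)

    Image : Pred (Fin n) 0ℓ → Pred (Fin n) 0ℓ
    Image C c = ∃[ v ] C v × r v ≡ c

    image? : ∀ {C : Pred (Fin n) 0ℓ} → Decidable C → Decidable (Image C)
    image? C? c = any? λ v → C? v ×-dec (r v ≟ c)

    project : Walk R a w b → Walk (Edge edges) (r a) (map r w) (r b)
    project [ u ]   = [ r u ]
    project (e ∷ W) =
      ∈-map⁺ r² (∈-filter⁺ R?′ (∈-cartesianProduct⁺ (∈-allFin _) (∈-allFin _)) e) ∷ project W

    cons : ∀ {u s v w w′} → r u ≡ r s → (∀ {z} → z ∈ w → r z ∈ w′) → r s ∈ w′ → Walk R s w v →
           ∃[ w₁ ] Walk R u w₁ v × (∀ {z} → z ∈ w₁ → r z ∈ w′)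
    cons {w′ = w′} eq w⊆ rs∈ W with fibre-connected eq
    ... | inj₁ refl = _ , W , w⊆
    ... | inj₂ e    = _ , e ∷ W , λ where
            (here refl) → subst (_∈ w′) (sym eq) rs∈
            (there z∈)  → w⊆ z∈

    -- Consecutive arcs lift to arcs of `R` whose facing ends share a fibre, and `cons` bridges
    -- them. The ends `u` and `v` are free within their fibres, so that they can be chosen in `A`
    -- and `B`.
    lift : ∀ {a b w′ u v} → Walk (Edge edges) a w′ b → r u ≡ a → r v ≡ b →
           ∃[ w ] Walk R u w v × (∀ {z} → z ∈ w → r z ∈ w′)
    lift [ _ ] ru rv = cons (trans ru (sym rv)) (λ { (here refl) → here rv }) (here rv) [ _ ]
    lift (e ∷ W) ru rv
      with (s , t) , st∈ , refl ← ∈-map⁻ r² e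
      with _ , Rst ← ∈-filter⁻ R?′ {xs = pairs} st∈
      with w , W′ , w⊆ ← lift W refl rv =
      cons ru (λ { (here refl) → here refl ; (there z∈) → there (w⊆ z∈) }) (here refl) (Rst ∷ W′)

  -- Menger's theorem in the image graph, lifted back: disjointness becomes disjointness of the
  -- fibres met, and `Z` consists of contracted vertices.
  mengerContraction : ∀ k →
    (Σ (Fin k → List (Fin n)) λ p → (∀ i → Connects R A B (p i)) ×
      (∀ {i j u v} → u ∈ p i → v ∈ p j → r u ≡ r v → i ≡ j)) ⊎
    (∃[ Z ] length Z < k × (∀ {w} → Connects R A B w → ∃[ v ] v ∈ w × r v ∈ Z))
  mengerContraction k with menger edges (image? A?) (image? B?) k
  ... | inj₂ (Z , Z<k , sep) = inj₂ (Z , Z<k , hit)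
    where
    hit : ∀ {w} → Connects R A B w → ∃[ v ] v ∈ w × r v ∈ Z
    hit (a , b , Aa , Bb , W)
      with c , c∈ , c∈Z ← sep (r a , r b , (a , Aa , refl) , (b , Bb , refl) , project W)
      with v , v∈ , refl ← ∈-map⁻ r c∈ = v , v∈ , c∈Z
  ... | inj₁ (p , conn , disj) = inj₁
    ( (λ i → proj₁ (lifted i))
    , (λ i → let _ , _ , (a , Aa , _) , (b , Bb , _) , _ = conn i in
             a , b , Aa , Bb , proj₁ (proj₂ (lifted i)))
    , λ {i} {j} u∈ v∈ eq →
        disj (subst (_∈ p i) eq (proj₂ (proj₂ (lifted i)) u∈)) (proj₂ (proj₂ (lifted j)) v∈))
    where
    lifted : ∀ i → _
    lifted i = let _ , _ , (_ , _ , ra) , (_ , _ , rb) , W = conn i in lift W ra rb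

-- Induced paths

-- Tight u s: the list u ∷ s is an induced path of E which ends in Y, and has no other
-- vertex in Y and none in X except possibly u.
data Tight {n} (E : Rel (Fin n) 0ℓ) (X Y : Pred (Fin n) 0ℓ) : Fin n → List (Fin n) → Set where
  end  : ∀ {b} → Y b → Tight E X Y b []
  step : ∀ {u v s} → E u v → ¬ Y u → ¬ X v → u ∉ v ∷ s → (∀ {z} → z ∈ s → ¬ E u z) →
         Tight E X Y v s → Tight E X Y u (v ∷ s)

module _ {n} {E : Rel (Fin n) 0ℓ} {X Y : Pred (Fin n) 0ℓ} where

  tightWalk : ∀ {u s} → Tight E X Y u s → ∃[ b ] Y b × Walk E u (u ∷ s) b
  tightWalk (end Yb) = _ , Yb , [ _ ]
  tightWalk (step e _ _ _ _ t) = let b , Yb , W = tightWalk t in b , Yb , e ∷ W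

  tightSuffix : ∀ {u s v} → Tight E X Y u s → v ∈ u ∷ s →
                ∃[ s′ ] Tight E X Y v s′ × v ∷ s′ ⊆ u ∷ s
  tightSuffix t (here refl) = _ , t , id
  tightSuffix (step _ _ _ _ _ t) (there v∈) =
    let s′ , t′ , ⊆s = tightSuffix t v∈ in s′ , t′ , there ∘ ⊆s

  module _ (E? : Decidable₂ E) (X? : Decidable X) (Y? : Decidable Y) where

    -- Jumping from `u` to its last neighbour on the path leaves no chord from `u`, as `step`
    -- demands; `¬ X` is carried along for the same constructor.
    lastNeighbour : ∀ u {v s} → Tight E X Y v s → ¬ X v →
      (∀ {z} → z ∈ v ∷ s → ¬ E u z) ⊎
      (∃₂ λ z s′ → Tight E X Y z s′ × ¬ X z × E u z × (∀ {y} → y ∈ s′ → ¬ E u y) × z ∷ s′ ⊆ v ∷ s)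
    lastNeighbour u {v} t@(end _) ¬Xv with E? u v
    ... | yes e = inj₂ (_ , _ , t , ¬Xv , e , (λ ()) , id)
    ... | no ¬e = inj₁ λ { (here refl) → ¬e }
    lastNeighbour u {v} t₀@(step _ _ ¬X _ _ t) ¬Xv with lastNeighbour u t ¬X | E? u v
    ... | inj₂ (z , s′ , t′ , ¬Xz , e , none , ⊆s) | _ = inj₂ (z , s′ , t′ , ¬Xz , e , none , there ∘ ⊆s)
    ... | inj₁ none | yes e = inj₂ (_ , _ , t₀ , ¬Xv , e , none , id)
    ... | inj₁ none | no ¬e = inj₁ λ { (here refl) → ¬e ; (there z∈) → none z∈ }

    -- The path is built from the back: an `X`-vertex discards everything before it, a `Y`-vertex
    -- everything after it, a repeated vertex cuts out the loop, and chords are shortcut by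
    -- `lastNeighbour`.
    tighten : ∀ {a w b} → Walk E a w b → Y b →
              ∃₂ λ h s → Tight E X Y h s × (h ≡ a ⊎ X h) × h ∷ s ⊆ w
    tighten [ _ ] Yb = _ , _ , end Yb , inj₁ refl , id
    tighten {a} (e ∷ W) Yb with tighten W Yb
    ... | h , s , t , inj₂ Xh , ⊆w = h , s , t , inj₂ Xh , there ∘ ⊆w
    ... | v , s , t , inj₁ refl , ⊆w with X? v | Y? a | a ∈? (v ∷ s)
    ...   | yes Xv | _      | _ = v , s , t , inj₂ Xv , there ∘ ⊆w
    ...   | no _   | yes Ya | _ = a , [] , end Ya , inj₁ refl , λ { (here refl) → here refl }
    ...   | no _   | no _   | yes a∈ =
              let s′ , t′ , ⊆s = tightSuffix t a∈ in a , s′ , t′ , inj₁ refl , there ∘ ⊆w ∘ ⊆s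
    ...   | no ¬Xv | no ¬Ya | no a∉ with lastNeighbour a t ¬Xv
    ...     | inj₁ none = contradiction e (none (here refl))
    ...     | inj₂ (z , s′ , t′ , ¬Xz , e′ , none , ⊆s) =
                a , z ∷ s′ , step e′ ¬Ya ¬Xz (a∉ ∘ ⊆s) none t′ , inj₁ refl ,
                λ { (here refl) → here refl ; (there z∈) → there (⊆w (⊆s z∈)) }

    tightenConnects : ∀ {w} → Connects E X Y w → ∃₂ λ h s → X h × Tight E X Y h s × h ∷ s ⊆ w
    tightenConnects (a , b , Xa , Yb , W) with tighten W Yb
    ... | h , s , t , inj₁ refl , ⊆w = h , s , Xa , t , ⊆w
    ... | h , s , t , inj₂ Xh , ⊆w   = h , s , Xh , t , ⊆w

  -- Counting membership in X and in Y as virtual neighbours, every vertex of a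
  -- tight path starting in X has exactly two neighbours on it.
  Neighbour : List (Fin n) → Fin n → Fin n ⊎ Bool → Set
  Neighbour L u (inj₁ v)     = v ∈ L × E u v
  Neighbour L u (inj₂ true)  = X u
  Neighbour L u (inj₂ false) = Y u

  record TwoNeighbours (L : List (Fin n)) (u : Fin n) : Set where
    field
      {α β} : Fin n ⊎ Bool
      α≢β   : α ≢ β
      nα    : Neighbour L u α
      nβ    : Neighbour L u β
      only  : ∀ γ → Neighbour L u γ → γ ≡ α ⊎ γ ≡ β

  module _ (E-sym : Symmetric E) (E-irrefl : ∀ {u} → ¬ E u u) where

    -- The slot `inj₂ true` is left open: `twoNeighbours` fills it with membership in `X`,
    -- `tailNeighbours` replaces it by the predecessor on the path.
    headNeighbour : ∀ {u s} → Tight E X Y u s →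
      ∃[ α ] α ≢ inj₂ true × Neighbour (u ∷ s) u α ×
      (∀ γ → Neighbour (u ∷ s) u γ → γ ≡ inj₂ true ⊎ γ ≡ α)
    headNeighbour (end Yu) = inj₂ false , (λ ()) , Yu , λ where
      (inj₁ _) (here refl , e) → contradiction e E-irrefl
      (inj₂ true) _  → inj₁ refl
      (inj₂ false) _ → inj₂ refl
    headNeighbour (step {v = v} e ¬Yu _ _ none _) = inj₁ v , (λ ()) , (there (here refl) , e) , λ where
      (inj₁ _) (here refl , e′)         → contradiction e′ E-irrefl
      (inj₁ _) (there (here refl) , _)  → inj₂ refl
      (inj₁ _) (there (there z∈) , e′)  → contradiction e′ (none z∈)
      (inj₂ true) _                     → inj₁ refl
      (inj₂ false) Yu                   → contradiction Yu ¬Yu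

    weakenNeighbour : ∀ {u L z} γ → Neighbour L z γ → Neighbour (u ∷ L) z γ
    weakenNeighbour (inj₁ _)     (z∈ , e) = there z∈ , e
    weakenNeighbour (inj₂ true)  x        = x
    weakenNeighbour (inj₂ false) y        = y

    tailNeighbours : ∀ {u s z} → Tight E X Y u s → z ∈ s → TwoNeighbours (u ∷ s) z
    tailNeighbours (step {u} {v} {s} e _ ¬Xv u∉ _ t) (here refl)
      with α , α≢ , nα , only ← headNeighbour t = record
      { α≢β  = λ { refl → u∉ (proj₁ nα) }
      ; nα   = here refl , E-sym e
      ; nβ   = weakenNeighbour α nα
      ; only = λ where
          (inj₁ _) (here refl , _) → inj₁ refl
          (inj₁ z) (there z∈ , e′) → [ (λ ()) , inj₂ ]′ (only (inj₁ z) (z∈ , e′))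
          (inj₂ true) Xv           → contradiction Xv ¬Xv
          (inj₂ false) Yv          → [ (λ ()) , inj₂ ]′ (only (inj₂ false) Yv)
      }
    tailNeighbours (step _ _ _ _ none t) (there z∈) = record
      { α≢β  = α≢β
      ; nα   = weakenNeighbour α nα
      ; nβ   = weakenNeighbour β nβ
      ; only = λ where
          (inj₁ _) (here refl , e) → contradiction (E-sym e) (none z∈)
          (inj₁ y) (there y∈ , e)  → only (inj₁ y) (y∈ , e)
          (inj₂ true) Xz           → only (inj₂ true) Xz
          (inj₂ false) Yz          → only (inj₂ false) Yz
      }
      where open TwoNeighbours (tailNeighbours t z∈)

    twoNeighbours : ∀ {u s z} → X u → Tight E X Y u s → z ∈ u ∷ s → TwoNeighbours (u ∷ s) z
    twoNeighbours Xu t (there z∈)  = tailNeighbours t z∈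
    twoNeighbours Xu t (here refl) with α , α≢ , nα , only ← headNeighbour t = record
      { α≢β = α≢ ∘ sym ; nα = Xu ; nβ = nα ; only = only }

-- Canonical representatives of the orbits of an involution

module Involution {n} (f : Fin n → Fin n) (f-invol : ∀ u → f (f u) ≡ u) where

  rep : Fin n → Fin n
  rep u with toℕ u ℕ.≤? toℕ (f u)
  ... | yes _ = u
  ... | no _  = f u

  rep-cases : ∀ u → rep u ≡ u ⊎ rep u ≡ f u
  rep-cases u with toℕ u ℕ.≤? toℕ (f u)
  ... | yes _ = inj₁ refl
  ... | no _  = inj₂ refl

  rep-f : ∀ u → rep (f u) ≡ rep u
  rep-f u with toℕ u ℕ.≤? toℕ (f u) | toℕ (f u) ℕ.≤? toℕ (f (f u))
  ... | yes u≤ | yes fu≤ = Fin.toℕ-injective (ℕ.≤-antisym (subst (λ v → toℕ (f u) ≤ toℕ v) (f-invol u) fu≤) u≤)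
  ... | yes _  | no _    = f-invol u
  ... | no _   | yes _   = refl
  ... | no u≰  | no fu≰  =
    contradiction (subst (λ v → toℕ (f u) ≤ toℕ v) (sym (f-invol u)) (ℕ.<⇒≤ (ℕ.≰⇒> u≰))) fu≰

  rep⁻ : ∀ u → u ≡ rep u ⊎ u ≡ f (rep u)
  rep⁻ u with rep-cases u
  ... | inj₁ eq = inj₁ (sym eq)
  ... | inj₂ eq = inj₂ (sym (trans (cong f eq) (f-invol u)))

  -- An orbit has at most two vertices, so expanding `Z` at most doubles it. This is the source of
  -- the factor 2 per colour.
  rep∈⁻ : ∀ {u Z} → rep u ∈ Z → u ∈ Z ++ map f Z
  rep∈⁻ {u} {Z} ∈Z with rep⁻ u
  ... | inj₁ eq = ∈-++⁺ˡ (subst (_∈ Z) (sym eq) ∈Z)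
  ... | inj₂ eq = ∈-++⁺ʳ Z (subst (_∈ map f Z) (sym eq) (∈-map⁺ f ∈Z))

  rep-injective : ∀ {u v} → rep u ≡ rep v → u ≡ v ⊎ f u ≡ v
  rep-injective {u} {v} eq with rep⁻ u | rep⁻ v
  ... | inj₁ p | inj₁ q = inj₁ (trans p (trans eq (sym q)))
  ... | inj₂ p | inj₂ q = inj₁ (trans p (trans (cong f eq) (sym q)))
  ... | inj₁ p | inj₂ q = inj₂ (trans (cong f (trans p eq)) (sym q))
  ... | inj₂ p | inj₁ q = inj₂ (trans (cong f p) (trans (f-invol _) (trans eq (sym q))))

-- Eliminating one colour at a time

module Colours (G : Graph) (X Y : Subset (Graph.n G)) {χ : ℕ} (col : StrongEdgeColouring G χ) where

  open Graph G using (adj)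
  open StrongEdgeColouring col

  private
    V : Set
    V = Fin (Graph.n G)

    _~_ : Rel V 0ℓ
    _~_ = Adj G

    _~?_ : Decidable₂ _~_
    u ~? v = T? (adj u v)

    ~-sym : Symmetric _~_
    ~-sym {u} {v} = subst T (Graph.sym G u v)

    ~-irrefl : ∀ {u} → ¬ u ~ u
    ~-irrefl {u} = Graph.irrefl G u

  -- Colours below `t` are the treated ones. For `t` equal to 0 this is equality; for `t` equal to
  -- `χ` it is equality or adjacency.
  Close : ℕ → Rel V 0ℓ
  Close t u v = u ≡ v ⊎ (Σ (u ~ v) λ h → toℕ (colour u v h) < t)

  InducedPath : List V → Set
  InducedPath w = ∃₂ λ h s → w ≡ h ∷ s × h ∈ₛ X × Tight _~_ (_∈ₛ X) (_∈ₛ Y) h s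

  inducedConnects : ∀ {w} → InducedPath w → Connects _~_ (_∈ₛ X) (_∈ₛ Y) w
  inducedConnects (h , s , refl , Xh , t) = let b , Yb , W = tightWalk t in h , b , Xh , Yb , W

  inducedNeighbours : ∀ {w u} → InducedPath w → u ∈ w →
                      TwoNeighbours {E = _~_} {X = _∈ₛ X} {Y = _∈ₛ Y} w u
  inducedNeighbours (h , s , refl , Xh , t) = twoNeighbours ~-sym ~-irrefl Xh t

  Family : ℕ → ℕ → Set
  Family t K = Σ (Fin K → List V) λ P → (∀ i → InducedPath (P i)) ×
    (∀ {i j u v} → u ∈ P i → v ∈ P j → Close t u v → i ≡ j)

  -- Tightening only drops vertices, so the paths become induced while `far` persists.
  tightenFamily : ∀ {t K} (p : Fin K → List V) → (∀ i → Connects _~_ (_∈ₛ X) (_∈ₛ Y) (p i)) →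
                  (∀ {i j u v} → u ∈ p i → v ∈ p j → Close t u v → i ≡ j) → Family t K
  tightenFamily p conn far =
    (λ i → proj₁ (tight i)) , (λ i → proj₁ (proj₂ (tight i))) ,
    λ {i} {j} u∈ v∈ → far (proj₂ (proj₂ (tight i)) u∈) (proj₂ (proj₂ (tight j)) v∈)
    where
    tight : ∀ i → ∃[ w ] InducedPath w × w ⊆ p i
    tight i = let h , s , Xh , t , ⊆w = tightenConnects _~?_ (_∈ₛ? X) (_∈ₛ? Y) (conn i) in
      h ∷ s , (h , s , refl , Xh , t) , ⊆w

  -- One round: treating the colour `t`

  module Halve {t K : ℕ} (P : Fin (2 * K) → List V) (induced-P : ∀ i → InducedPath (P i))
    (far : ∀ {i j u v} → u ∈ P i → v ∈ P j → Close t u v → i ≡ j) where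

    Matched : Rel V 0ℓ
    Matched u v = Σ (u ~ v) λ h → toℕ (colour u v h) ≡ t

    matched? : Decidable₂ Matched
    matched? u v with u ~? v
    ... | no ¬h = no (¬h ∘ proj₁)
    ... | yes h = map′ (h ,_) (λ (h′ , eq) → subst (λ h → toℕ (colour u v h) ≡ t) (T-irrelevant h′ h) eq)
                       (toℕ (colour u v h) ℕ.≟ t)

    matched-sym : Symmetric Matched
    matched-sym {u} {v} (h , eq) =
      ~-sym h , trans (cong toℕ (sym (colour-sym u v h (~-sym h)))) eq

    -- Two edges of one induced matching with equal or adjacent ends must coincide, up to
    -- orientation.
    matched-induced : ∀ {u v u′ v′} → Matched u u′ → Matched v v′ → u ≡ v ⊎ u ~ v →
                      (u ≡ v × u′ ≡ v′) ⊎ (u ≡ v′ × u′ ≡ v)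
    matched-induced {u} {v} {u′} {v′} (h , eq) (h′ , eq′) close
      with induced u u′ v v′ h h′ (Fin.toℕ-injective (trans eq (sym eq′)))
    ... | inj₁ same = same
    ... | inj₂ apart = let u≢v , u≁v = apart u v (inj₁ refl) (inj₁ refl) in
            contradiction close [ u≢v , u≁v ]′

    matched-unique : ∀ {u v v′} → Matched u v → Matched u v′ → v ≡ v′
    matched-unique m m′ with matched-induced m m′ (inj₁ refl)
    ... | inj₁ (_ , eq)     = eq
    ... | inj₂ (refl , refl) = refl

    Used : Pred V 0ℓ
    Used v = ∃[ i ] v ∈ P i

    used? : Decidable Used
    used? v = any? λ i → v ∈? (P i)

    SamePath : Rel V 0ℓ
    SamePath u v = u ~ v × ∃[ i ] u ∈ P i × v ∈ P i

    Link : Rel V 0ℓ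
    Link u v = Matched u v × Used u × Used v

    link? : Decidable₂ Link
    link? u v = matched? u v ×-dec (used? u ×-dec used? v)

    link-sym : Symmetric Link
    link-sym (m , u , v) = matched-sym m , v , u

    -- Since each `P i` is induced, `SamePath` contains exactly the edges of the old paths. Hence an
    -- `H`-walk can leave an old path only along an edge of colour `t`.
    H : Rel V 0ℓ
    H u v = SamePath u v ⊎ Link u v

    H? : Decidable₂ H
    H? u v = ((u ~? v) ×-dec any? (λ i → u ∈? (P i) ×-dec v ∈? (P i))) ⊎-dec link? u v

    H-sym : Symmetric H
    H-sym (inj₁ (h , i , u∈ , v∈)) = inj₁ (~-sym h , i , v∈ , u∈)
    H-sym (inj₂ l)                 = inj₂ (link-sym l)

    H⇒~ : ∀ {u v} → H u v → u ~ v
    H⇒~ (inj₁ (h , _))       = h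
    H⇒~ (inj₂ ((h , _) , _)) = h

    H⇒used : ∀ {u v} → H u v → Used v
    H⇒used (inj₁ (_ , i , _ , v∈)) = i , v∈
    H⇒used (inj₂ (_ , _ , v))      = v

    partner : V → V
    partner u with any? (link? u)
    ... | yes (v , _) = v
    -- Fixing the unlinked vertices makes `partner` an involution on all of `V`.
    ... | no _        = u

    partner-cases : ∀ u → partner u ≡ u ⊎ Link u (partner u)
    partner-cases u with any? (link? u)
    ... | yes (_ , l) = inj₂ l
    ... | no _        = inj₁ refl

    link⇒partner : ∀ {u v} → Link u v → partner u ≡ v
    link⇒partner {u} l with any? (link? u)
    ... | yes (_ , l′) = matched-unique (proj₁ l′) (proj₁ l)
    ... | no ¬l        = contradiction (_ , l) ¬l

    partner-involutive : ∀ u → partner (partner u) ≡ u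
    partner-involutive u with partner-cases u
    ... | inj₁ eq = trans (cong partner eq) eq
    ... | inj₂ l  = link⇒partner (link-sym l)

    open Involution partner partner-involutive

    fibre-connected : ∀ {u v} → rep u ≡ rep v → u ≡ v ⊎ H u v
    fibre-connected {u} {v} eq with rep-injective {u} {v} eq | partner-cases u
    ... | inj₁ u≡v | _         = inj₁ u≡v
    ... | inj₂ fu≡v | inj₁ fu≡u = inj₁ (trans (sym fu≡u) fu≡v)
    ... | inj₂ refl | inj₂ l    = inj₂ (inj₂ l)

    -- Restricting the ends excludes one-vertex walks off the old paths; since `H`-steps end in used
    -- vertices, all new walks stay within the old ones' vertices.
    Xᵤ Yᵤ : Pred V 0ℓ
    Xᵤ v = v ∈ₛ X × Used v
    Yᵤ v = v ∈ₛ Y × Used v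

    Xᵤ? : Decidable Xᵤ
    Xᵤ? v = (v ∈ₛ? X) ×-dec used? v

    Yᵤ? : Decidable Yᵤ
    Yᵤ? v = (v ∈ₛ? Y) ×-dec used? v

    P-connects : ∀ i → Connects H Xᵤ Yᵤ (P i)
    P-connects i = let a , b , Xa , Yb , W = inducedConnects (induced-P i) in
      a , b , (Xa , i , head∈ W) , (Yb , i , last∈ W) ,
      mapWalk (λ u∈ v∈ e → inj₁ (e , i , u∈ , v∈)) W

    -- Every P i meets Z or its partners, in distinct vertices.
    no-small-separator : ∀ Z → length Z < K → ¬ (∀ {w} → Connects H Xᵤ Yᵤ w → ∃[ v ] v ∈ w × rep v ∈ Z)
    no-small-separator Z Z<K sep = contradiction 2K≤ (ℕ.<⇒≱ (ℕ.+-mono-< Z<K (ℕ.+-mono-<-≤ Z<K ℕ.z≤n)))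
      where
      hit : ∀ i → ∃[ v ] v ∈ P i × rep v ∈ Z
      hit i = sep (P-connects i)

      v : Fin (2 * K) → V
      v i = proj₁ (hit i)

      v∈ : ∀ i → v i ∈ Z ++ map partner Z
      v∈ i = rep∈⁻ (proj₂ (proj₂ (hit i)))

      2K≤ : 2 * K ≤ length Z + (length Z + 0)
      2K≤ = subst (2 * K ≤_)
        (trans (length-++ Z) (cong (length Z +_) (trans (length-map partner Z) (sym (ℕ.+-identityʳ _)))))
        (injective⇒≤length (Z ++ map partner Z) v v∈ λ {i} {j} eq →
          far (proj₁ (proj₂ (hit i))) (proj₁ (proj₂ (hit j))) (inj₁ eq))

    abstract
      rerouted : Σ (Fin K → List V) λ q → (∀ i → Connects H Xᵤ Yᵤ (q i)) ×
                 (∀ {i j u v} → u ∈ q i → v ∈ q j → rep u ≡ rep v → i ≡ j)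
      rerouted = [ id , (λ (Z , Z<K , sep) → ⊥-elim (no-small-separator Z Z<K sep)) ]′
        (Contraction.mengerContraction rep fibre-connected H? Xᵤ? Yᵤ? K)

    tightRoute : ∀ i → ∃₂ λ h s → Xᵤ h × Tight H Xᵤ Yᵤ h s × h ∷ s ⊆ proj₁ rerouted i
    tightRoute i = tightenConnects H? Xᵤ? Yᵤ? (proj₁ (proj₂ rerouted) i)

    Q : Fin K → List V
    Q i = let h , s , _ = tightRoute i in h ∷ s

    Q-disjoint : ∀ {i j u v} → u ∈ Q i → v ∈ Q j → rep u ≡ rep v → i ≡ j
    Q-disjoint {i} {j} u∈ v∈ =
      let _ , _ , _ , _ , ⊆i = tightRoute i ; _ , _ , _ , _ , ⊆j = tightRoute j in
      proj₂ (proj₂ rerouted) (⊆i u∈) (⊆j v∈)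

    walk-used : ∀ {a w b v} → Walk H a w b → Used a → v ∈ w → Used v
    walk-used [ _ ]   used (here refl) = used
    walk-used (_ ∷ _) used (here refl) = used
    walk-used (e ∷ W) used (there v∈)  = walk-used W (H⇒used e) v∈

    Q-used : ∀ {i v} → v ∈ Q i → Used v
    Q-used {i} v∈ = let _ , _ , (_ , used) , t , _ = tightRoute i ; _ , _ , W = tightWalk t in
      walk-used W used v∈

    -- On its old path u has only two neighbours (counting ends), one of which is v;
    -- so the new path through u, which misses v, must use the matching edge at u.
    leaves-by-matching : ∀ {i m u v} → u ∈ Q i → v ∉ Q i → u ∈ P m → v ∈ P m → u ~ v →
                         ∃[ z ] z ∈ Q i × Matched u z
    leaves-by-matching {i} {m} {u} {v} u∈Q v∉Q u∈P v∈P u~v = conclude (classify α nα) (classify β nβ)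
      where
      new : TwoNeighbours {E = H} {X = Xᵤ} {Y = Yᵤ} (Q i) u
      new = let _ , _ , Ah , t , _ = tightRoute i in twoNeighbours H-sym (~-irrefl ∘ H⇒~) Ah t u∈Q

      open TwoNeighbours new

      old : TwoNeighbours {E = _~_} {X = _∈ₛ X} {Y = _∈ₛ Y} (P m) u
      old = inducedNeighbours (induced-P m) u∈P

      Old : V ⊎ Bool → Set
      Old γ = Neighbour {E = _~_} {X = _∈ₛ X} {Y = _∈ₛ Y} (P m) u γ × γ ≢ inj₁ v

      classify : ∀ γ → Neighbour {E = H} {X = Xᵤ} {Y = Yᵤ} (Q i) u γ →
                 Old γ ⊎ ∃[ z ] z ∈ Q i × Matched u z
      classify (inj₁ z) (z∈ , inj₂ (m , _)) = inj₂ (z , z∈ , m)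
      -- Old paths are disjoint, so a `SamePath` edge at `u` runs along `P m` itself.
      classify (inj₁ z) (z∈ , inj₁ (u~z , m′ , u∈′ , z∈′)) with refl ← far u∈P u∈′ (inj₁ refl) =
        inj₁ ((z∈′ , u~z) , λ { refl → v∉Q z∈ })
      classify (inj₂ true)  (Xu , _) = inj₁ (Xu , λ ())
      classify (inj₂ false) (Yu , _) = inj₁ (Yu , λ ())

      conclude : Old α ⊎ ∃[ z ] z ∈ Q i × Matched u z → Old β ⊎ ∃[ z ] z ∈ Q i × Matched u z →
                 ∃[ z ] z ∈ Q i × Matched u z
      conclude (inj₂ z) _        = z
      conclude (inj₁ _) (inj₂ z) = z
      -- Otherwise `α`, `β` and `inj₁ v` would be three distinct neighbours of `u` on `P m`, which
      -- has only two.
      conclude (inj₁ (oα , α≢v)) (inj₁ (oβ , β≢v))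
        with TwoNeighbours.only old α oα | TwoNeighbours.only old β oβ
           | TwoNeighbours.only old (inj₁ v) (v∈P , u~v)
      ... | inj₁ p | inj₁ q | _      = contradiction (trans p (sym q)) α≢β
      ... | inj₂ p | inj₂ q | _      = contradiction (trans p (sym q)) α≢β
      ... | inj₁ p | inj₂ q | inj₁ r = contradiction (trans p (sym r)) α≢v
      ... | inj₁ p | inj₂ q | inj₂ r = contradiction (trans q (sym r)) β≢v
      ... | inj₂ p | inj₁ q | inj₁ r = contradiction (trans q (sym r)) β≢v
      ... | inj₂ p | inj₁ q | inj₂ r = contradiction (trans p (sym r)) α≢v

    rep-link : ∀ {u v} → Link u v → rep u ≡ rep v
    rep-link {u} l = trans (sym (rep-f u)) (cong rep (link⇒partner l))

    Q-far : ∀ {i j u v} → u ∈ Q i → v ∈ Q j → Close (suc t) u v → i ≡ j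
    Q-far u∈ v∈ (inj₁ refl) = Q-disjoint u∈ v∈ refl
    Q-far {i} {j} {u} {v} u∈ v∈ (inj₂ (h , <1+t)) with ℕ.m≤n⇒m<n∨m≡n (ℕ.s≤s⁻¹ <1+t) | i ≟ j
    ... | _ | yes i≡j = i≡j
    -- An edge of colour `t` between used vertices was contracted, so its ends share a
    -- representative.
    ... | inj₂ ≡t | _ = Q-disjoint u∈ v∈ (rep-link ((h , ≡t) , Q-used u∈ , Q-used v∈))
    ... | inj₁ <t | no i≢j
      with a , u∈P ← Q-used {i} u∈ | b , v∈P ← Q-used {j} v∈
      -- By the invariant, an edge of an earlier colour has both ends on one old path.
      with refl ← far u∈P v∈P (inj₂ (h , <t))
      with z , z∈ , m ← leaves-by-matching {i} u∈ (λ v∈′ → i≢j (Q-disjoint v∈′ v∈ refl)) u∈P v∈P h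
         | z′ , z′∈ , m′ ← leaves-by-matching {j} v∈ (λ u∈′ → i≢j (Q-disjoint u∈ u∈′ refl)) v∈P u∈P (~-sym h)
      -- The edge `h` joins the matching edges at `u` and `v`, so these coincide; then `u` equals
      -- `v` or `z′`, and either way lies on `Q j`.
      with matched-induced m m′ (inj₂ h)
    ... | inj₁ (u≡v , _)  = contradiction (Q-disjoint u∈ v∈ (cong rep u≡v)) i≢j
    ... | inj₂ (u≡z′ , _) = contradiction (Q-disjoint u∈ z′∈ (cong rep u≡z′)) i≢j

    halved : Family (suc t) K
    -- `Q` is induced in `H` only; tightening in `G` removes chords that are not in `H`.
    halved = tightenFamily Q (λ i → let h , s , (Xh , _) , t , _ = tightRoute i
                                        b , (Yb , _) , W = tightWalk t in
                              h , b , Xh , Yb , mapWalk (λ _ _ → H⇒~) W) Q-far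

  iterate : ∀ d {t} k → Family t (2 ^ d * k) → Family (d + t) k
  iterate zero    {t} k F = subst (Family t) (ℕ.+-identityʳ k) F
  iterate (suc d) {t} k F with P , ind , far ← subst (Family t) (ℕ.*-assoc 2 (2 ^ d) k) F =
    subst (λ t → Family t k) (ℕ.+-suc d t) (iterate d k (Halve.halved P ind far))

-- Translation to list paths and subsets, and the theorem

reverseWalk : ∀ {R : Rel (Fin n) 0ℓ} → Symmetric R → Walk R a w b → ∃[ w′ ] Walk R b w′ a × w′ ⊆ w
reverseWalk R-sym [ u ] = _ , [ u ] , id
reverseWalk R-sym (r ∷ W) with _ , W′ , w′⊆ ← reverseWalk R-sym W
  with w″ , J , split ← joinVia (R-sym r) W′ [ _ ] =
  w″ , J , λ v∈ → [ there ∘ w′⊆ , (λ { (here refl) → here refl }) ]′ (split v∈)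

linked⇒walk : ∀ {R : Rel (Fin n) 0ℓ} {q} → Linked R (a ∷ q) → last (a ∷ q) ≡ just b → Walk R a (a ∷ q) b
linked⇒walk [-]     refl = [ _ ]
linked⇒walk (r ∷ L) eq   = r ∷ linked⇒walk L eq

toSubset : List (Fin n) → Subset n
toSubset []       = ⊥ₛ
toSubset (v ∷ vs) = toSubset vs [ v ]≔ inside

∣p[v]≔inside∣≤ : ∀ (p : Subset n) v → ∣ p [ v ]≔ inside ∣ ≤ suc ∣ p ∣
∣p[v]≔inside∣≤ (outside ∷ p) zero    = ℕ.≤-refl
∣p[v]≔inside∣≤ (inside  ∷ p) zero    = ℕ.n≤1+n _
∣p[v]≔inside∣≤ (outside ∷ p) (suc v) = ∣p[v]≔inside∣≤ p v
∣p[v]≔inside∣≤ (inside  ∷ p) (suc v) = s≤s (∣p[v]≔inside∣≤ p v)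

-- Only an inequality, since the list may repeat vertices.
∣toSubset∣≤length : (vs : List (Fin n)) → ∣ toSubset vs ∣ ≤ length vs
∣toSubset∣≤length {n} []   = ℕ.≤-reflexive (∣⊥∣≡0 n)
∣toSubset∣≤length (v ∷ vs) = ℕ.≤-trans (∣p[v]≔inside∣≤ (toSubset vs) v) (s≤s (∣toSubset∣≤length vs))

∈-toSubset⁺ : ∀ {v} {vs : List (Fin n)} → v ∈ vs → v ∈ₛ toSubset vs
∈-toSubset⁺ {v = v} {vs = u ∷ vs} v∈ with u ≟ v | v∈
... | yes refl | _         = []≔-updates (toSubset vs) u
... | no u≢v   | here refl = contradiction refl u≢v
... | no u≢v   | there v∈′ = []≔-minimal (toSubset vs) v u (u≢v ∘ sym) (∈-toSubset⁺ v∈′)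

module _ {E : Rel (Fin n) 0ℓ} {X Y : Pred (Fin n) 0ℓ} where

  tight⇒unique : ∀ {u s} → Tight E X Y u s → Unique (u ∷ s)
  tight⇒unique (end _)             = [] ∷ []
  tight⇒unique (step _ _ _ u∉ _ t) = All.tabulate (λ { z∈ refl → u∉ z∈ }) ∷ tight⇒unique t

  tight⇒linked : ∀ {u s} → Tight E X Y u s → Linked E (u ∷ s)
  tight⇒linked (end _)            = [-]
  tight⇒linked (step e _ _ _ _ t) = e ∷ tight⇒linked t

  tight⇒last : ∀ {u s} → Tight E X Y u s → ∃[ b ] last (u ∷ s) ≡ just b × Y b
  tight⇒last (end Yb)           = _ , refl , Yb
  tight⇒last (step _ _ _ _ _ t) = tight⇒last t

theorem1p5 : (k : ℕ) → 1 ≤ k → (G : Graph) → (X Y : Subset (Graph.n G)) →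
    (χ : ℕ) → IsStrongChromaticIndex G χ →
    NonAdjPaths G k X Y ⊎
    (Σ (Subset (Graph.n G)) λ Z → (∣ Z ∣ < (2 ^ χ) * k) × Separates G Z X Y)
theorem1p5 k _ G X Y χ (col , _)
  -- With `id` all fibres are singletons, so this is Menger's theorem for `G` itself.
  with Contraction.mengerContraction {R = Adj G} id inj₁ (λ u v → T? (Graph.adj G u v))
         (_∈ₛ? X) (_∈ₛ? Y) (2 ^ χ * k)
... | inj₂ (Z , Z< , sep) = inj₂ (toSubset Z , ℕ.≤-<-trans (∣toSubset∣≤length Z) Z< , separates)
  where
  separates : Separates G (toSubset Z) X Y
  separates _ ((_ , _ , L) , a , b , (_ , refl) , last≡b , inj₁ (Xa , Yb)) =
    let v , v∈ , v∈Z = sep (a , b , Xa , Yb , linked⇒walk L last≡b) in v , v∈ , ∈-toSubset⁺ v∈Z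
  -- A path listed from `Y` to `X` is reversed, because `sep` speaks of walks from `X` to `Y`.
  separates _ ((_ , _ , L) , a , b , (_ , refl) , last≡b , inj₂ (Ya , Xb)) =
    let _ , W , ⊆p   = reverseWalk (λ {u} {v} → subst T (Graph.sym G u v)) (linked⇒walk L last≡b)
        v , v∈ , v∈Z = sep (b , a , Xb , Ya , W)
    in v , ⊆p v∈ , ∈-toSubset⁺ v∈Z
... | inj₁ (p , conn , disj) = inj₁ (Q , path , λ i j i≢j u∈ v∈ →
        (λ u≡v → i≢j (far u∈ v∈ (inj₁ u≡v))) ,
        -- After `χ` rounds every colour is treated, so any edge makes its ends `Close`.
        (λ h → i≢j (far u∈ v∈ (inj₂ (h , ℕ.<-≤-trans (Fin.toℕ<n _) (ℕ.m≤m+n χ 0))))))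
  where
  open Colours G X Y col

  family : Family (χ + 0) k
  family = iterate χ k (tightenFamily p conn λ where
    u∈ v∈ (inj₁ u≡v)      → disj u∈ v∈ u≡v
    -- No colour is below 0, so initially disjointness is the whole invariant.
    _  _  (inj₂ (_ , ())))

  Q : Fin k → List (Fin (Graph.n G))
  Q = proj₁ family

  far : ∀ {i j u v} → u ∈ Q i → v ∈ Q j → Close (χ + 0) u v → i ≡ j
  far = proj₂ (proj₂ family)

  toPath : ∀ {w} → InducedPath w → IsXYPath G X Y w
  toPath (h , s , refl , Xh , t) = let b , eq , Yb = tight⇒last t in
    ((λ ()) , tight⇒unique t , tight⇒linked t) , h , b , (s , refl) , eq , inj₁ (Xh , Yb)

  path : ∀ i → IsXYPath G X Y (Q i)
  path i = toPath (proj₁ (proj₂ family) i)
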